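{- Let $(\Sigma,I)$ be a trace alphabet, let $\varphi$ be a formula of $\mathrm{LTL}(\Sigma,I)$, and let $\mathcal A=(\Sigma,Q,Q_0,\delta,F)$ be a nondeterministic Büchi automaton with $\mathcal L(\mathcal A)=\{w\in\Sigma^\omega\mid T_w\models\varphi\}$. For $u\in\Sigma^\ast$ let $L_u=\bigcup_{q\in\delta(Q_0,u)}\mathcal L(\mathcal A(q))\subseteq\Sigma^\omega$. Then for all $u,v\in\Sigma^\ast$ with $u\approx v$, $$L_u=L_v.$$
   Context: **Trace alphabet.** A trace alphabet is a pair $(\Sigma,I)$ where $\Sigma$ is a finite non-empty set and $I\subseteq\Sigma\times\Sigma$ is irreflexive and symmetric (independence). Put $D=(\Sigma\times\Sigma)\setminus I$ (dependency). $\Sigma^\infty=\Sigma^\ast\cup\Sigma^\omega$ is the set of finite and infinite words. **Traces.** A trace over $(\Sigma,I)$ is a $\Sigma$-labelled poset $T=(E,\leq,\lambda)$, $\lambda:E\to\Sigma$, such that: (i) ${\downarrow}e=\{x\in E\mid x\le e\}$ is finite for every $e\in E$; (ii) if $e'$ covers $e$ (i.e. $e<e'$ and nothing lies strictly between), then $(\lambda(e),\lambda(e'))\in D$; (iii) if $(\lambda(e),\lambda(e'))\in D$ then $e\le e'$ or $e'\le e$. Isomorphic traces are identified. **Configurations.** A configuration of $T$ is a finite set $c\subseteq E$ that is downward closed. $\mathcal C_T$ is the set of configurations. For $c,c'\in\mathcal C_T$ and $a\in\Sigma$, $c\xrightarrow{a}_T c'$ means there is $e\in E\setminus c$ with $\lambda(e)=a$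 and $c'=c\cup\{e\}$. **Linearisations and equivalence.** $w\in\Sigma^\infty$ is a linearisation of $T$ iff there is a map $\rho$ from the finite prefixes of $w$ to $\mathcal C_T$ with $\rho(\varepsilon)=\emptyset$, $\rho(v)\xrightarrow{a}_T\rho(va)$ for each finite prefix $va$ of $w$, and every $e\in E$ belongs to $\rho(u)$ for some finite prefix $u$ of $w$. For $w,w'\in\Sigma^\infty$, $w\approx w'$ iff $w{\upharpoonright}p=w'{\upharpoonright}p$ for every $p\subseteq\Sigma$ with $p\times p\subseteq D$, where $w{\upharpoonright}p$ erases from $w$ all letters not in $p$. For $w\in\Sigma^\infty$, $T_w$ is the unique (up to isomorphism) trace having $w$ as a linearisation; its set of linearisations is the $\approx$-class of $w$. (Concretely: events are the positions of $w$, labelled by their letters, and $\le$ is the reflexive-transitive closure of $\{(i,j)\mid i<j,\ (w_i,w_j)\in D\}$.) **Logic.** Formulas of $\mathrm{LTL}(\Sigma,I)$ (also called LTrL) are given by $\varphi::=\mathrm{tt}\mid\neg\varphi\mid\varphi\vee\psi\mid\langle a\rangle\varphi\mid\varphi\,\mathcal U\,\psi$ with $a\in\Sigma$. For a trace $T$ and $c\in\mathcal C_T$: $T,c\models\mathrm{tt}$ always; $\neg,\vee$ are interpreted as usual; $T,c\models\langle a\rangle\varphi$ iff there is $c'\in\mathcal C_T$ with $c\xrightarrow{a}_T c'$ and $T,c'\models\varphi$; $T,c\models\varphi\,\mathcal U\,\psi$ iff there is $c'\in\mathcal C_T$ with $c\subseteq c'$, $T,c'\models\psi$, and $T,c''\models\varphi$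 for all $c''\in\mathcal C_T$ with $c\subseteq c''\subsetneq c'$. $T\models\varphi$ means $T,\emptyset\models\varphi$. **Automata.** A nondeterministic Büchi automaton is $\mathcal A=(\Sigma,Q,Q_0,\delta,F)$ with $Q$ finite non-empty, $Q_0\subseteq Q$ the initial states, $\delta:Q\times\Sigma\to 2^Q$ (extended as usual to sets of states and finite words), and $F\subseteq Q$; it accepts $w\in\Sigma^\omega$ iff it has a run on $w$ starting in $Q_0$ and visiting $F$ infinitely often. $\mathcal A(q)$ is $\mathcal A$ with initial state set replaced by $\{q\}$. -}

module Defs where

open import Data.Fin.Base using (Fin)
open import Data.Fin.Subset as Subset using (Subset)
open import Data.Fin.Subset.Properties using (_∈?_)
open import Data.List.Base using (List; []; _∷_; filter; upTo)
open import Data.List.Membership.Propositional using (_∈_; _∉_)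
open import Data.List.Membership.Propositional.Properties using (∈-upTo⁺)
open import Data.List.Relation.Binary.BagAndSetEquality using (_∼[_]_; set)
import Data.List.Relation.Binary.Subset.Propositional as List
open import Data.Nat.Base as ℕ using (ℕ; suc; s≤s)
import Data.Nat.Properties as ℕ
open import Data.Product.Base using (Σ-syntax; ∃-syntax; _×_; _,_)
open import Data.Sum.Base using (_⊎_; inj₁; inj₂)
open import Data.Unit.Base using (⊤)
open import Level using (0ℓ)
open import Relation.Binary.Construct.Closure.ReflexiveTransitive using (Star; ε; _◅_; _◅◅_)
open import Relation.Binary.Core using (Rel)
open import Relation.Binary.Definitions using (Irreflexive; Symmetric; tri<; tri≈; tri>)
open import Relation.Binary.PropositionalEquality
  using (_≡_; _≢_; refl; isEquivalence)
open import Relation.Binary.Structures using (IsPartialOrder)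
open import Relation.Nullary.Negation.Core using (¬_; contradiction)
open import Relation.Nullary.Decidable using (yes; no)
import Relation.Unary as Pred
open Pred using (Pred; ｛_｝)

-- Finite non-empty sets (of letters, of states) are taken to be Fin (suc n).
record TraceAlphabet : Set₁ where
  field
    pred-size : ℕ

  Letter : Set
  Letter = Fin (suc pred-size)

  field
    I        : Rel Letter 0ℓ
    I-irrefl : Irreflexive _≡_ I
    I-sym    : Symmetric I

  D : Rel Letter 0ℓ
  D a b = ¬ I a b

ωWord : Set → Set
ωWord X = ℕ → X

module _ (Al : TraceAlphabet) where
  open TraceAlphabet Al

  record Trace : Set₁ where
    field
      Event          : Set
      _≤_            : Rel Event 0ℓ
      isPartialOrder : IsPartialOrder _≡_ _≤_
      label          : Event → Letter

    _<_ : Rel Event 0ℓ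
    e < e′ = e ≤ e′ × e ≢ e′

    _⋖_ : Rel Event 0ℓ
    e ⋖ e′ = e < e′ × ¬ (∃[ x ] (e < x × x < e′))

    field
      ↓-finite             : ∀ e → ∃[ xs ] (∀ x → x ≤ e → x ∈ xs)
      cover⇒dependent      : ∀ e e′ → e ⋖ e′ → D (label e) (label e′)
      dependent⇒comparable : ∀ e e′ → D (label e) (label e′) → e ≤ e′ ⊎ e′ ≤ e

  data Formula : Set where
    tt   : Formula
    ¬′_  : Formula → Formula
    _∨′_ : Formula → Formula → Formula
    ⟨_⟩_ : Letter → Formula → Formula
    _𝒰_  : Formula → Formula → Formula

module _ {Al : TraceAlphabet} where
  open TraceAlphabet Al

  module _ (T : Trace Al) where
    open Trace T

    -- A finite set of events is a list, considered up to having the same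
    -- elements: order and repetitions are ignored by all the relations below.
    record Configuration : Set where
      field
        events      : List Event
        down-closed : ∀ {x e} → x ≤ e → e ∈ events → x ∈ events

    open Configuration

    ∅ : Configuration
    ∅ = record { events = [] ; down-closed = λ _ () }

    _⊑_ : Rel Configuration 0ℓ
    c ⊑ c′ = events c List.⊆ events c′

    _⊏_ : Rel Configuration 0ℓ
    c ⊏ c′ = c ⊑ c′ × ¬ (c′ ⊑ c)

    -- The last component says that c′ = c ∪ {e}.
    Step : Configuration → Letter → Configuration → Set
    Step c a c′ =
      ∃[ e ] (e ∉ events c × label e ≡ a × events c′ ∼[ set ] (e ∷ events c))

    Sat : Configuration → Formula Al → Set
    Sat c tt        = ⊤
    Sat c (¬′ φ)    = ¬ Sat c φ
    Sat c (φ ∨′ ψ)  = Sat c φ ⊎ Sat c ψ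
    Sat c (⟨ a ⟩ φ) = ∃[ c′ ] (Step c a c′ × Sat c′ φ)
    Sat c (φ 𝒰 ψ)   =
      ∃[ c′ ] (c ⊑ c′ × Sat c′ ψ × (∀ c″ → c ⊑ c″ → c″ ⊏ c′ → Sat c″ φ))

  _⊨_ : Trace Al → Formula Al → Set
  T ⊨ φ = Sat T (∅ T) φ

  module _ (w : ωWord Letter) where

    _≺_ : Rel ℕ 0ℓ
    i ≺ j = i ℕ.< j × D (w i) (w j)

    private
      ≺*⇒≤ : ∀ {i j} → Star _≺_ i j → i ℕ.≤ j
      ≺*⇒≤ ε               = ℕ.≤-refl
      ≺*⇒≤ ((i<k , _) ◅ p) = ℕ.≤-trans (ℕ.<⇒≤ i<k) (≺*⇒≤ p)

      cover : ∀ i j → Star _≺_ i j × i ≢ j →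
              ¬ (∃[ k ] ((Star _≺_ i k × i ≢ k) × (Star _≺_ k j × k ≢ j))) →
              D (w i) (w j)
      cover i .i (ε , i≢i) _ = contradiction refl i≢i
      cover i j (_◅_ {j = k} (i<k , d) p , _) none with k ℕ.≟ j
      ... | yes refl = d
      ... | no k≢j   =
        contradiction (k , (((i<k , d) ◅ ε) , ℕ.<⇒≢ i<k) , (p , k≢j)) none

      comparable : ∀ i j → D (w i) (w j) → Star _≺_ i j ⊎ Star _≺_ j i
      comparable i j d with ℕ.<-cmp i j
      ... | tri< i<j _ _  = inj₁ ((i<j , d) ◅ ε)
      ... | tri≈ _ refl _ = inj₁ ε
      ... | tri> _ _ j<i  = inj₂ ((j<i , λ Iji → d (I-sym Iji)) ◅ ε)

    -- The trace T_w: its events are the positions of w.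
    traceOf : Trace Al
    traceOf = record
      { Event          = ℕ
      ; _≤_            = Star _≺_
      ; isPartialOrder = record
        { isPreorder = record
          { isEquivalence = isEquivalence
          ; reflexive     = λ { refl → ε }
          ; trans         = _◅◅_
          }
        ; antisym = λ p q → ℕ.≤-antisym (≺*⇒≤ p) (≺*⇒≤ q)
        }
      ; label                = w
      ; ↓-finite             = λ e → upTo (suc e) , λ x p → ∈-upTo⁺ (s≤s (≺*⇒≤ p))
      ; cover⇒dependent      = λ { i j (i<j , none) → cover i j i<j none }
      ; dependent⇒comparable = comparable
      }

-- Sets of letters are decidable here, since projecting a word computes with them.
LetterSet : TraceAlphabet → Set
LetterSet Al = Subset (suc (TraceAlphabet.pred-size Al))

module _ (Al : TraceAlphabet) where
  open TraceAlphabet Al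

  _↾_ : List Letter → LetterSet Al → List Letter
  u ↾ p = filter (_∈? p) u

  TraceEquivalent : Rel (List Letter) 0ℓ
  TraceEquivalent u v =
    ∀ (p : LetterSet Al) → (∀ {a b} → a Subset.∈ p → b Subset.∈ p → D a b) →
    u ↾ p ≡ v ↾ p

record BüchiAutomaton (X : Set) : Set₁ where
  field
    pred-states : ℕ

  State : Set
  State = Fin (suc pred-states)

  field
    Q₀ : Pred State 0ℓ
    δ  : State → X → Pred State 0ℓ
    F  : Pred State 0ℓ

  δ* : Pred State 0ℓ → List X → Pred State 0ℓ
  δ* S []      = S
  δ* S (a ∷ u) = δ* (λ q′ → ∃[ q ] (q Pred.∈ S × q′ Pred.∈ δ q a)) u

module _ {X : Set} where
  open BüchiAutomaton

  -- 𝒜 from S is 𝒜 with its initial state set replaced by S.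
  _from_ : (𝒜 : BüchiAutomaton X) → Pred (State 𝒜) 0ℓ → BüchiAutomaton X
  𝒜 from S = record 𝒜 { Q₀ = S }

  𝓛 : BüchiAutomaton X → Pred (ωWord X) 0ℓ
  𝓛 𝒜 w = Σ[ r ∈ (ℕ → State 𝒜) ]
    ( r 0 Pred.∈ Q₀ 𝒜
    × (∀ i → r (suc i) Pred.∈ δ 𝒜 (r i) (w i))
    × (∀ n → ∃[ m ] (n ℕ.≤ m × r m Pred.∈ F 𝒜)))

  -- The language L_u.
  residual : BüchiAutomaton X → List X → Pred (ωWord X) 0ℓ
  residual 𝒜 u x = ∃[ q ] (q Pred.∈ δ* 𝒜 (Q₀ 𝒜) u × x Pred.∈ 𝓛 (𝒜 from ｛ q ｝))

{-# OPTIONS --safe #-}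

-- The language L_u is the set of all x with ux ∈ 𝓛(𝒜), that is, T_{ux} ⊨ φ, and
-- satisfaction is invariant under isomorphism of traces; so it suffices that
-- T_{ux} ≅ T_{vx} whenever u ≈ v. This goes by induction on u: if u = a u′,
-- then v = v₁ a v₂ with a not in v₁, and comparing the projections to {a, b}
-- shows that every letter b of v₁ is independent of a. Hence a can be moved to
-- the front of v, and u′ ≈ v₁ v₂. Since I need not be decidable, independence
-- appears below only in the form ¬ D, and an isomorphism is kept as a bijection
-- of positions which preserves the order of dependent positions.
module Submission where

open import Data.Fin.Properties using (_≟_)
open import Data.Fin.Subset as Subset using (⁅_⁆; _∪_)
open import Data.Fin.Subset.Properties using (_∈?_; x∈⁅x⁆; x∈⁅y⁆⇒x≡y; x∈p∪q⁺; x∈p∪q⁻)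
open import Data.List.Base using (List; []; _∷_; _++_; map)
open import Data.List.Membership.Propositional using (_∈_; _∉_)
open import Data.List.Membership.Propositional.Properties
  using (∈-map⁺; ∈-map⁻; ∈-filter⁺; ∈-filter⁻)
open import Data.List.Properties
  using (filter-accept; filter-reject; filter-none; filter-++; ∷-injectiveˡ; ∷-injectiveʳ)
open import Data.List.Relation.Unary.All as All using (All; []; _∷_)
open import Data.List.Relation.Unary.Any using (here; there)
open import Data.List.Relation.Unary.First as First using (FirstView; first)
open import Data.List.Relation.Unary.First.Properties using (toView)
open import Data.Nat.Base as ℕ using (ℕ; zero; suc; z≤n; s≤s)
import Data.Nat.Properties as ℕ
open import Data.Product.Base using (∃-syntax; _×_; _,_; proj₁)
open import Data.Sum.Base as Sum using (inj₁; inj₂)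
open import Function.Base using (_∘_)
open import Function.Bundles using (_↔_; Inverse; Equivalence; mk↔ₛ′; mk⇔)
open import Function.Properties.Inverse using (↔-refl; ↔-sym; ↔-trans)
open import Level using (0ℓ)
open import Relation.Binary.Construct.Closure.ReflexiveTransitive using (gmap)
open import Relation.Binary.Definitions using (tri<; tri≈; tri>)
open import Relation.Binary.PropositionalEquality
  using (_≡_; _≢_; refl; sym; trans; cong; subst; subst₂; module ≡-Reasoning)
open import Relation.Nullary.Decidable using (yes; no; toSum)
open import Relation.Nullary.Negation.Core using (¬_; contradiction)
open import Relation.Unary using (Pred; _≐_; _⊆_; ｛_｝)
open import Defs

-- Finite prefixes of infinite words and of Büchi runs.

infixr 5 _∷ω_ _++ω_

_∷ω_ : {X : Set} → X → ωWord X → ωWord X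
(a ∷ω w) zero    = a
(a ∷ω w) (suc i) = w i

_++ω_ : {X : Set} → List X → ωWord X → ωWord X
[]      ++ω x = x
(a ∷ u) ++ω x = a ∷ω (u ++ω x)

module _ {X : Set} (𝒜 : BüchiAutomaton X) where
  open BüchiAutomaton 𝒜

  -- `S` is arbitrary because `δ*` replaces it by its set of successors at each letter. With
  -- `split-run` this identifies `residual 𝒜 u` as the set of `x` for which `𝒜` accepts `u ++ω x`.
  prefix-run : ∀ (S : Pred State 0ℓ) u {x q} →
    δ* S u q → 𝓛 (𝒜 from ｛ q ｝) x → 𝓛 (𝒜 from S) (u ++ω x)
  prefix-run S [] q∈S (r , refl , steps , acc) = r , q∈S , steps , acc
  prefix-run S (a ∷ u) {x} q∈ run with prefix-run _ u q∈ run
  ... | r , (p , p∈S , r₀∈δ) , steps , acc = r′ , p∈S , steps′ , acc′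
    where
    r′ : ℕ → State
    r′ = p ∷ω r

    steps′ : ∀ i → δ (r′ i) ((a ∷ω (u ++ω x)) i) (r′ (suc i))
    steps′ zero    = r₀∈δ
    steps′ (suc i) = steps i

    acc′ : ∀ n → ∃[ m ] (n ℕ.≤ m × F (r′ m))
    acc′ n with acc n
    ... | m , n≤m , rm∈F = suc m , ℕ.m≤n⇒m≤1+n n≤m , rm∈F

  split-run : ∀ (S : Pred State 0ℓ) u {x} →
    𝓛 (𝒜 from S) (u ++ω x) → ∃[ q ] (δ* S u q × 𝓛 (𝒜 from ｛ q ｝) x)
  split-run S [] (r , r₀∈S , steps , acc) = r 0 , r₀∈S , r , refl , steps , acc
  split-run S (a ∷ u) (r , r₀∈S , steps , acc) =
    split-run _ u (r ∘ suc , (r 0 , r₀∈S , steps 0) , steps ∘ suc , acc′)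
    where
    acc′ : ∀ n → ∃[ m ] (n ℕ.≤ m × F (r (suc m)))
    -- A visit to `F` at or after `suc n` has a positive index, so it survives dropping the first
    -- state.
    acc′ n with acc (suc n)
    ... | suc m , s≤s n≤m , rm∈F = m , n≤m , rm∈F

module _ {Al : TraceAlphabet} where
  open TraceAlphabet Al
  open Trace
  open Configuration

  -- Trace isomorphisms and invariance of satisfaction.

  infix 4 _≅_ _≅ω_

  record _≅_ (T T′ : Trace Al) : Set where
    field
      bijection : Event T ↔ Event T′
    open Inverse bijection public using (to; from; strictlyInverseˡ; strictlyInverseʳ)
    field
      label-to  : ∀ e → label T′ (to e) ≡ label T e
      to-mono   : ∀ {e e′} → _≤_ T e e′ → _≤_ T′ (to e) (to e′)
      from-mono : ∀ {e e′} → _≤_ T′ e e′ → _≤_ T (from e) (from e′)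

  ≅-sym : ∀ {T T′} → T ≅ T′ → T′ ≅ T
  ≅-sym {T} {T′} ι = record
    { bijection = ↔-sym bijection
    ; label-to  = λ e → trans (sym (label-to (from e))) (cong (label T′) (strictlyInverseˡ e))
    ; to-mono   = from-mono
    ; from-mono = to-mono
    }
    where open _≅_ ι

  module _ {T T′ : Trace Al} (ι : T ≅ T′) where
    open _≅_ ι

    -- A relation rather than an equation with `image c`, since configurations matter only up to
    -- having the same elements. Exchanging the two fields gives the relation for the inverse
    -- isomorphism.
    record Corresponds (c : Configuration T) (c′ : Configuration T′) : Set where
      field
        forth : ∀ {e} → e ∈ events c → to e ∈ events c′
        back  : ∀ {e} → e ∈ events c′ → from e ∈ events c

    image : Configuration T → Configuration T′
    image c = record { events = map to (events c) ; down-closed = closed }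
      where
      closed : ∀ {x e} → _≤_ T′ x e → e ∈ map to (events c) → x ∈ map to (events c)
      closed {x} x≤e e∈ with ∈-map⁻ to e∈
      ... | e₀ , e₀∈c , refl = subst (_∈ _) (strictlyInverseˡ x)
        (∈-map⁺ to (down-closed c
          (subst (_≤_ T (from x)) (strictlyInverseʳ e₀) (from-mono x≤e)) e₀∈c))

    image-corresponds : ∀ c → Corresponds c (image c)
    image-corresponds c = record { forth = ∈-map⁺ to ; back = back′ }
      where
      back′ : ∀ {e} → e ∈ map to (events c) → from e ∈ events c
      back′ e∈ with ∈-map⁻ to e∈
      ... | e₀ , e₀∈c , refl = subst (_∈ events c) (sym (strictlyInverseʳ e₀)) e₀∈c

  module _ {T T′ : Trace Al} (ι : T ≅ T′) where
    open _≅_ ι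
    open Corresponds

    Corresponds-sym : ∀ {c c′} → Corresponds ι c c′ → Corresponds (≅-sym ι) c′ c
    Corresponds-sym r = record { forth = back r ; back = forth r }

    module _ {c d : Configuration T} {c′ d′ : Configuration T′}
             (r : Corresponds ι c c′) (s : Corresponds ι d d′) where

      ⊑-transfer : _⊑_ T c d → _⊑_ T′ c′ d′
      ⊑-transfer c⊑d {x} x∈c′ =
        subst (_∈ events d′) (strictlyInverseˡ x) (forth s (c⊑d (back r x∈c′)))

      Step-transfer : ∀ {a} → Step T c a d → Step T′ c′ a d′
      Step-transfer (e , e∉c , refl , d≈e∷c) =
        to e , to-e∉c′ , label-to e , mk⇔ d′⊆ ⊆d′
        where
        to-e∉c′ : to e ∉ events c′
        to-e∉c′ to-e∈c′ = e∉c (subst (_∈ events c) (strictlyInverseʳ e) (back r to-e∈c′))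

        d′⊆ : ∀ {x} → x ∈ events d′ → x ∈ to e ∷ events c′
        d′⊆ {x} x∈d′ with Equivalence.to d≈e∷c (back s x∈d′)
        ... | here refl = here (sym (strictlyInverseˡ x))
        ... | there x∈c = there (subst (_∈ events c′) (strictlyInverseˡ x) (forth r x∈c))

        ⊆d′ : ∀ {x} → x ∈ to e ∷ events c′ → x ∈ events d′
        ⊆d′ (here refl)      = forth s (Equivalence.from d≈e∷c (here refl))
        ⊆d′ {x} (there x∈c′) = subst (_∈ events d′) (strictlyInverseˡ x)
          (forth s (Equivalence.from d≈e∷c (there (back r x∈c′))))

  -- One implication suffices because `ι` is generalised in the induction on the formula: negation
  -- reverses the direction and uses the inverse isomorphism.
  Sat-transfer : ∀ {T T′ : Trace Al} (ι : T ≅ T′) φ {c c′} → Corresponds ι c c′ →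
    Sat T c φ → Sat T′ c′ φ
  Sat-transfer ι tt        r _         = _
  Sat-transfer ι (¬′ φ)    r ¬s        =
    ¬s ∘ Sat-transfer (≅-sym ι) φ (Corresponds-sym ι r)
  Sat-transfer ι (φ ∨′ ψ)  r           = Sum.map (Sat-transfer ι φ r) (Sat-transfer ι ψ r)
  Sat-transfer ι (⟨ a ⟩ φ) r (d , st , s) =
    image ι d , Step-transfer ι r d~ st , Sat-transfer ι φ d~ s
    where d~ = image-corresponds ι d
  Sat-transfer {T} {T′} ι (φ 𝒰 ψ) {c} {c′} r (d , c⊑d , s , between) =
    image ι d , ⊑-transfer ι r d~ c⊑d , Sat-transfer ι ψ d~ s , between′
    where
    d~ = image-corresponds ι d

    between′ : ∀ c″ → _⊑_ T′ c′ c″ → _⊏_ T′ c″ (image ι d) → Sat T′ c″ φ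
    -- An intermediate configuration of `T′` is pulled back to `b`, which lies between `c` and `d`;
    -- there `φ` is known, and it is carried forward again.
    between′ c″ c′⊑c″ (c″⊑d′ , d′⋢c″) = Sat-transfer ι φ b~
      (between b (⊑-transfer (≅-sym ι) r⁻¹ b~⁻¹ c′⊑c″)
        ( ⊑-transfer (≅-sym ι) b~⁻¹ (Corresponds-sym ι d~) c″⊑d′
        , λ d⊑b → d′⋢c″ (⊑-transfer ι d~ b~ d⊑b)))
      where
      b    = image (≅-sym ι) c″
      b~⁻¹ = image-corresponds (≅-sym ι) c″
      r⁻¹  = Corresponds-sym ι r

      b~ : Corresponds ι b c″
      b~ = record { forth = Corresponds.back b~⁻¹ ; back = Corresponds.forth b~⁻¹ }

  ⊨-resp-≅ : ∀ {T T′ : Trace Al} φ → T ≅ T′ → T ⊨ φ → T′ ⊨ φ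
  ⊨-resp-≅ φ ι = Sat-transfer ι φ (record { forth = λ () ; back = λ () })

  -- Reorderings of infinite words.

  D-refl : ∀ {a} → D a a
  D-refl = I-irrefl refl

  D-sym : ∀ {a b} → D a b → D b a
  D-sym d = d ∘ I-sym

  infix 4 _⊢_≺_

  _⊢_≺_ : ωWord Letter → ℕ → ℕ → Set
  w ⊢ i ≺ j = _≺_ {Al} w i j

  record _≅ω_ (w w′ : ωWord Letter) : Set where
    field
      bijection : ℕ ↔ ℕ
    open Inverse bijection public using (to; from; strictlyInverseˡ; strictlyInverseʳ)
    field
      label-to : ∀ i → w′ (to i) ≡ w i
      to-mono  : ∀ {i j} → w ⊢ i ≺ j → to i ℕ.< to j

  ≅ω-refl : ∀ {w} → w ≅ω w
  ≅ω-refl = record { bijection = ↔-refl ; label-to = λ _ → refl ; to-mono = proj₁ }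

  module _ {w w′ : ωWord Letter} (π : w ≅ω w′) where
    open _≅ω_ π

    ≺-to : ∀ {i j} → w ⊢ i ≺ j → w′ ⊢ to i ≺ to j
    ≺-to {i} {j} (i<j , d) =
      to-mono (i<j , d) , subst₂ D (sym (label-to i)) (sym (label-to j)) d

    label-from : ∀ i → w (from i) ≡ w′ i
    label-from i = trans (sym (label-to (from i))) (cong w′ (strictlyInverseˡ i))

    -- Dependent positions are comparable, so preserving their order implies reflecting it.
    ≺-from : ∀ {i j} → w′ ⊢ i ≺ j → w ⊢ (from i) ≺ (from j)
    ≺-from {i} {j} (i<j , d) with ℕ.<-cmp (from i) (from j)
    ... | tri< lt _ _ = lt , subst₂ D (sym (label-from i)) (sym (label-from j)) d
    ... | tri≈ _ eq _ = contradiction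
      (trans (sym (strictlyInverseˡ i)) (trans (cong to eq) (strictlyInverseˡ j))) (ℕ.<⇒≢ i<j)
    ... | tri> _ _ gt = contradiction
      (subst₂ ℕ._<_ (strictlyInverseˡ j) (strictlyInverseˡ i)
        (to-mono (gt , subst₂ D (sym (label-from j)) (sym (label-from i)) (D-sym d))))
      (ℕ.<-asym i<j)

    -- The order of `traceOf w` is the reflexive-transitive closure of `≺`, so it is enough to map
    -- single `≺` steps in both directions.
    traceOf-≅ : traceOf {Al} w ≅ traceOf w′
    traceOf-≅ = record
      { bijection = bijection
      ; label-to  = label-to
      ; to-mono   = gmap to ≺-to
      ; from-mono = gmap _ ≺-from
      }

  ≅ω-trans : ∀ {w w′ w″} → w ≅ω w′ → w′ ≅ω w″ → w ≅ω w″
  ≅ω-trans π ρ = record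
    { bijection = ↔-trans (_≅ω_.bijection π) (_≅ω_.bijection ρ)
    ; label-to  = λ i → trans (_≅ω_.label-to ρ _) (_≅ω_.label-to π i)
    ; to-mono   = λ i≺j → _≅ω_.to-mono ρ (≺-to π i≺j)
    }

  ∷ω-cong : ∀ a {w w′} → w ≅ω w′ → (a ∷ω w) ≅ω (a ∷ω w′)
  ∷ω-cong a {w} {w′} π = record
    { bijection = mk↔ₛ′ (lift to) (lift (Inverse.from bijection))
        (lift-inverse strictlyInverseˡ) (lift-inverse strictlyInverseʳ)
    ; label-to  = λ { zero → refl ; (suc i) → label-to i }
    ; to-mono   = mono
    }
    where
    open _≅ω_ π

    lift : (ℕ → ℕ) → ℕ → ℕ
    lift f zero    = zero
    lift f (suc i) = suc (f i)

    lift-inverse : ∀ {f g} → (∀ i → f (g i) ≡ i) → ∀ i → lift f (lift g i) ≡ i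
    lift-inverse fg zero    = refl
    lift-inverse fg (suc i) = cong suc (fg i)

    mono : ∀ {i j} → (a ∷ω w) ⊢ i ≺ j → lift to i ℕ.< lift to j
    mono {zero}  {suc j} _             = s≤s z≤n
    mono {suc i} {suc j} (s≤s i<j , d) = s≤s (to-mono (i<j , d))

  swap-≅ω : ∀ {a b} w → ¬ D a b → (a ∷ω b ∷ω w) ≅ω (b ∷ω a ∷ω w)
  swap-≅ω {a} {b} w ¬d = record
    { bijection = mk↔ₛ′ swap swap swap-involutive swap-involutive
    ; label-to  = λ { zero → refl ; (suc zero) → refl ; (suc (suc i)) → refl }
    ; to-mono   = mono
    }
    where
    swap : ℕ → ℕ
    swap zero          = 1
    swap (suc zero)    = 0
    swap (suc (suc i)) = suc (suc i)

    swap-involutive : ∀ i → swap (swap i) ≡ i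
    swap-involutive zero          = refl
    swap-involutive (suc zero)    = refl
    swap-involutive (suc (suc i)) = refl

    mono : ∀ {i j} → (a ∷ω b ∷ω w) ⊢ i ≺ j → swap i ℕ.< swap j
    -- Positions 0 and 1 are the only pair whose order is reversed, and they are not dependent.
    mono {zero}        {suc zero}    (_ , d)       = contradiction d ¬d
    mono {zero}        {suc (suc j)} _             = s≤s (s≤s z≤n)
    mono {suc zero}    {suc zero}    (s≤s () , _)
    mono {suc zero}    {suc (suc j)} _             = s≤s z≤n
    mono {suc (suc i)} {suc zero}    (s≤s () , _)
    mono {suc (suc i)} {suc (suc j)} (i<j , _)     = i<j

  -- The letter `a` is swapped with the head of `v₁` and then moved on inside the tail.
  move-≅ω : ∀ {a v₁} v₂ x → All (¬_ ∘ D a) v₁ →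
    (a ∷ω ((v₁ ++ v₂) ++ω x)) ≅ω ((v₁ ++ a ∷ v₂) ++ω x)
  move-≅ω v₂ x []         = ≅ω-refl
  move-≅ω v₂ x (¬d ∷ ¬ds) = ≅ω-trans (swap-≅ω _ ¬d) (∷ω-cong _ (move-≅ω v₂ x ¬ds))

  -- Projections to cliques and the first occurrence of a letter.

  Clique : LetterSet Al → Set
  Clique p = ∀ {a b} → a Subset.∈ p → b Subset.∈ p → D a b

  pair : Letter → Letter → LetterSet Al
  pair a b = ⁅ a ⁆ ∪ ⁅ b ⁆

  ∈-pairˡ : ∀ {a b} → a Subset.∈ pair a b
  ∈-pairˡ {a} = x∈p∪q⁺ (inj₁ (x∈⁅x⁆ a))

  ∈-pairʳ : ∀ {a b} → b Subset.∈ pair a b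
  ∈-pairʳ {b = b} = x∈p∪q⁺ (inj₂ (x∈⁅x⁆ b))

  pair-clique : ∀ {a b} → D a b → Clique (pair a b)
  pair-clique {a} {b} d x∈ y∈ with x∈p∪q⁻ ⁅ a ⁆ ⁅ b ⁆ x∈ | x∈p∪q⁻ ⁅ a ⁆ ⁅ b ⁆ y∈
  ... | inj₁ x∈a | inj₁ y∈a rewrite x∈⁅y⁆⇒x≡y a x∈a | x∈⁅y⁆⇒x≡y a y∈a = D-refl
  ... | inj₁ x∈a | inj₂ y∈b rewrite x∈⁅y⁆⇒x≡y a x∈a | x∈⁅y⁆⇒x≡y b y∈b = d
  ... | inj₂ x∈b | inj₁ y∈a rewrite x∈⁅y⁆⇒x≡y b x∈b | x∈⁅y⁆⇒x≡y a y∈a = D-sym d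
  ... | inj₂ x∈b | inj₂ y∈b rewrite x∈⁅y⁆⇒x≡y b x∈b | x∈⁅y⁆⇒x≡y b y∈b = D-refl

  infix 8 _↓_

  _↓_ : List Letter → LetterSet Al → List Letter
  _↓_ = _↾_ Al

  -- `pair a a` is the singleton of `a`, a clique because `D` is reflexive; projecting to it detects
  -- whether `a` occurs.
  ∈-resp-≈ : ∀ u v {a} → TraceEquivalent Al u v → a ∈ u → a ∈ v
  ∈-resp-≈ u v {a} u≈v a∈u = proj₁ (∈-filter⁻ (_∈? p) {xs = v}
    (subst (a ∈_) (u≈v p (pair-clique D-refl)) (∈-filter⁺ (_∈? p) a∈u ∈-pairˡ)))
    where p = pair a a

  first-occurrence : ∀ {a : Letter} v → a ∈ v → FirstView (a ≢_) (a ≡_) v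
  first-occurrence {a} v a∈v with first (λ b → Sum.swap (toSum (a ≟ b))) v
  ... | inj₁ f    = toView f
  ... | inj₂ none = contradiction refl (All.lookup none a∈v)

  module _ {a : Letter} (u v₁ v₂ : List Letter)
           (u≈v : TraceEquivalent Al (a ∷ u) (v₁ ++ a ∷ v₂)) where

    -- If a letter b of v₁ depended on a, the projection of v to {a, b} would start
    -- inside v₁, whereas that of a ∷ u starts with a.
    first-independent : All (a ≢_) v₁ → All (¬_ ∘ D a) v₁
    first-independent a∉v₁ = All.tabulate λ {b} b∈v₁ d →
      let p = pair a b in
      starts-with-a
        (∈-filter⁻ (_∈? p))
        (∈-filter⁺ (_∈? p) b∈v₁ ∈-pairʳ)
        (trans (sym (filter-accept (_∈? p) ∈-pairˡ))
          (trans (u≈v p (pair-clique d)) (filter-++ (_∈? p) v₁ (a ∷ v₂))))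
      where
      -- `xs` abstracts the projection of `v₁`, so that it can be matched on. It is nonempty because
      -- of `b`, and its head, a letter of `v₁`, differs from `a`.
      starts-with-a : ∀ {P : Pred Letter 0ℓ} {b xs ys zs} →
        (∀ {c} → c ∈ xs → c ∈ v₁ × P c) → b ∈ xs → ¬ (a ∷ ys ≡ xs ++ zs)
      starts-with-a {xs = c ∷ xs} xs⊆ _ eq =
        All.lookup a∉v₁ (proj₁ (xs⊆ (here refl))) (∷-injectiveˡ eq)

    -- If the clique `p` contains `a`, it contains no letter of `v₁`, so both projections start with
    -- `a`, which cancels. Otherwise the projection erases `a` on both sides.
    cancel-first : All (¬_ ∘ D a) v₁ → TraceEquivalent Al u (v₁ ++ v₂)
    cancel-first ¬ds p cl with a ∈? p
    ... | yes a∈p = ∷-injectiveʳ (begin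
      a ∷ u ↓ p                ≡⟨ filter-accept (_∈? p) a∈p ⟨
      (a ∷ u) ↓ p              ≡⟨ u≈v p cl ⟩
      (v₁ ++ a ∷ v₂) ↓ p       ≡⟨ filter-++ (_∈? p) v₁ (a ∷ v₂) ⟩
      v₁ ↓ p ++ (a ∷ v₂) ↓ p   ≡⟨ cong (_++ (a ∷ v₂) ↓ p) v₁↓p≡[] ⟩
      (a ∷ v₂) ↓ p             ≡⟨ filter-accept (_∈? p) a∈p ⟩
      a ∷ v₂ ↓ p               ≡⟨ cong (λ xs → a ∷ xs ++ v₂ ↓ p) v₁↓p≡[] ⟨
      a ∷ v₁ ↓ p ++ v₂ ↓ p     ≡⟨ cong (a ∷_) (filter-++ (_∈? p) v₁ v₂) ⟨
      a ∷ (v₁ ++ v₂) ↓ p       ∎)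
      where
      open ≡-Reasoning

      v₁↓p≡[] : v₁ ↓ p ≡ []
      v₁↓p≡[] = filter-none (_∈? p) (All.map (λ ¬d b∈p → ¬d (cl a∈p b∈p)) ¬ds)
    ... | no a∉p = begin
      u ↓ p                    ≡⟨ filter-reject (_∈? p) a∉p ⟨
      (a ∷ u) ↓ p              ≡⟨ u≈v p cl ⟩
      (v₁ ++ a ∷ v₂) ↓ p       ≡⟨ filter-++ (_∈? p) v₁ (a ∷ v₂) ⟩
      v₁ ↓ p ++ (a ∷ v₂) ↓ p   ≡⟨ cong (v₁ ↓ p ++_) (filter-reject (_∈? p) a∉p) ⟩
      v₁ ↓ p ++ v₂ ↓ p         ≡⟨ filter-++ (_∈? p) v₁ v₂ ⟨
      (v₁ ++ v₂) ↓ p           ∎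
      where open ≡-Reasoning

  -- From trace equivalence to equality of the residual languages.

  ++ω-≅ω : ∀ u v x → TraceEquivalent Al u v → (u ++ω x) ≅ω (v ++ω x)
  ++ω-≅ω [] []      x u≈v = ≅ω-refl
  ++ω-≅ω [] (b ∷ v) x u≈v with ∈-resp-≈ (b ∷ v) [] (λ p cl → sym (u≈v p cl)) (here {x = b} refl)
  ... | ()
  ++ω-≅ω (a ∷ u) v x u≈v with first-occurrence {a} v (∈-resp-≈ (a ∷ u) v u≈v (here refl))
  ... | First._++_∷_ {v₁} a∉v₁ refl v₂ =
    -- The remainders `u` and `v₁ ++ v₂` are matched behind a common `a`, which is then carried past
    -- `v₁` to its place in `v`.
    ≅ω-trans (∷ω-cong a (++ω-≅ω u (v₁ ++ v₂) x (cancel-first u v₁ v₂ u≈v ind))) (move-≅ω v₂ x ind)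
    where ind = first-independent u v₁ v₂ u≈v a∉v₁

  residual-⊆ : ∀ φ (𝒜 : BüchiAutomaton Letter) → 𝓛 𝒜 ≐ (λ w → traceOf w ⊨ φ) →
    ∀ u v → TraceEquivalent Al u v → residual 𝒜 u ⊆ residual 𝒜 v
  residual-⊆ φ 𝒜 (sound , complete) u v u≈v {x} (q , q∈ , run) =
    split-run 𝒜 _ v (complete (⊨-resp-≅ φ (traceOf-≅ (++ω-≅ω u v x u≈v))
      (sound (prefix-run 𝒜 _ u q∈ run))))

lemma2 : (Al : TraceAlphabet) (φ : Formula Al)
    (𝒜 : BüchiAutomaton (TraceAlphabet.Letter Al)) →
    𝓛 𝒜 ≐ (λ w → traceOf w ⊨ φ) →
    (u v : List (TraceAlphabet.Letter Al)) →
    TraceEquivalent Al u v →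
    residual 𝒜 u ≐ residual 𝒜 v
lemma2 Al φ 𝒜 𝓛𝒜≐φ u v u≈v =
  residual-⊆ φ 𝒜 𝓛𝒜≐φ u v u≈v ,
  residual-⊆ φ 𝒜 𝓛𝒜≐φ v u (λ p cl → sym (u≈v p cl))
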